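{- Let $D$ be a digraph with vertex set $\{v_1,\dots,v_n\}$, and let $ED$ be the extended digraph obtained by replacing each $v_i$ by an independent set $I_i$ of size $s_i\ge 1$, where every $s_i$ is odd. Then $\chi'_{\mathrm{wo}}(ED)=\chi'_{\mathrm{wo}}(D)$.
   Context: All digraphs are finite, without loops or parallel arcs (a pair of opposite arcs $uv, vu$ is allowed). Given $D$ with vertices $v_1,\dots,v_n$ and positive integers $s_1,\dots,s_n$, the extended digraph $ED$ has vertex set $I_1\cup\dots\cup I_n$ (disjoint sets, $|I_i|=s_i$, each $I_i$ independent), and for $x\in I_i$, $y\in I_j$ there is an arc $xy$ iff $v_iv_j\in A(D)$. For a vertex $v$, the semi-cuts of $v$ are $\partial^+(v)$ (arcs leaving $v$) and $\partial^-(v)$ (arcs entering $v$). A map $\varphi:A(D)\to[k]=\{1,\dots,k\}$ satisfies condition (WO) at $v$ if there is a color $i\in[k]$ such that every nonempty semi-cut of $v$ contains an odd number of arcs of color $i$ (vacuous if both semi-cuts are empty). A weak-odd $k$-edge coloring is such a map satisfying (WO) at every vertex, and the weak-odd chromatic index $\chi'_{\mathrm{wo}}(D)$ is the least $k\ge0$ for which one exists. -}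

module Defs where

open import Data.Nat using (ℕ; zero; suc; _+_; _%_; _≤_)
open import Data.Bool using (Bool; true; false; T; if_then_else_)
open import Data.Unit using (tt)
open import Data.Fin as Fin using (Fin; zero; suc; splitAt)
open import Data.Sum using (_⊎_; inj₁; inj₂)
open import Data.Product using (Σ; _×_; _,_; proj₁; proj₂; ∃)
open import Data.List using (map; allFin)
open import Data.Nat.ListAction using (sum)
open import Relation.Nullary.Decidable using (⌊_⌋)
open import Relation.Binary.PropositionalEquality using (_≡_)

-- A digraph on vertex set Fin n: arcs given by a Boolean adjacency relation
-- (so no parallel arcs; opposite arcs uv, vu allowed), with no loops.
record Digraph : Set where
  field
    n        : ℕ
    adj      : Fin n → Fin n → Bool
    loopless : ∀ v → adj v v ≡ false
open Digraph public

Arc : Digraph → Set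
Arc D = Σ (Fin (n D) × Fin (n D)) λ p → T (adj D (proj₁ p) (proj₂ p))

ind : ∀ {k} (b : Bool) → (T b → Fin k) → Fin k → ℕ
ind false f i = 0
ind true  f i = if ⌊ f tt Fin.≟ i ⌋ then 1 else 0

outCount : ∀ {k} (D : Digraph) → (Arc D → Fin k) → Fin (n D) → Fin k → ℕ
outCount D φ v i =
  sum (map (λ w → ind (adj D v w) (λ t → φ ((v , w) , t)) i) (allFin (n D)))

inCount : ∀ {k} (D : Digraph) → (Arc D → Fin k) → Fin (n D) → Fin k → ℕ
inCount D φ v i =
  sum (map (λ w → ind (adj D w v) (λ t → φ ((w , v) , t)) i) (allFin (n D)))

Odd : ℕ → Set
Odd m = m % 2 ≡ 1

OutNonempty InNonempty : (D : Digraph) → Fin (n D) → Set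
OutNonempty D v = ∃ λ w → T (adj D v w)
InNonempty  D v = ∃ λ w → T (adj D w v)

WO : ∀ {k} (D : Digraph) → (Arc D → Fin k) → Fin (n D) → Set
WO {k} D φ v =
  ((∀ w → adj D v w ≡ false) × (∀ w → adj D w v ≡ false))
  ⊎ (Σ (Fin k) λ i → (OutNonempty D v → Odd (outCount D φ v i))
                   × (InNonempty D v → Odd (inCount D φ v i)))

WeakOddColoring : (D : Digraph) (k : ℕ) → (Arc D → Fin k) → Set
WeakOddColoring D k φ = ∀ v → WO D φ v

WOColorable : Digraph → ℕ → Set
WOColorable D k = Σ (Arc D → Fin k) (WeakOddColoring D k)

IsWOChromaticIndex : Digraph → ℕ → Set
IsWOChromaticIndex D k = WOColorable D k × (∀ j → WOColorable D j → k ≤ j)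

-- Extended digraph: vertex v_i replaced by an independent set I_i of size s i.
-- Vertices of ED are Fin (total s); blocks are consecutive, block i has size s i.
total : ∀ {m} → (Fin m → ℕ) → ℕ
total {zero}  s = 0
total {suc m} s = s zero + total (λ i → s (suc i))

owner : ∀ {m} (s : Fin m → ℕ) → Fin (total s) → Fin m
owner {suc m} s x with splitAt (s zero) x
... | inj₁ _ = zero
... | inj₂ y = suc (owner (λ i → s (suc i)) y)

extended : (D : Digraph) → (Fin (n D) → ℕ) → Digraph
extended D s = record
  { n        = total s
  ; adj      = λ x y → adj D (owner s x) (owner s y)
  ; loopless = λ x → loopless D (owner s x)
  }

{-# OPTIONS --safe #-}
-- The two digraphs admit weak-odd colorings with the same numbers k of colors.
-- A coloring of D pulls back to ED, since blocks have odd size. Conversely, for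
-- k = 2 color the arc v_i v_j by the color that occurs an odd number of times
-- between I_i and I_j, and let v_i use the color used by an odd number of
-- vertices of I_i; the cases k ≤ 1 are immediate. For k ≥ 3 nothing is left to
-- transfer, because every digraph has a weak-odd 3-edge coloring:
-- Choose vertex-disjoint directed cycles whose removal leaves an acyclic digraph,
-- and give their arcs color 2 and all other arcs color 0. As long as no other arc
-- touching a cycle gets color 2, the vertices on cycles are satisfied by color 2.
-- Any other vertex lies on a path that starts at a source or with an arc from a
-- cycle, and ends at a sink or with an arc to a cycle. The path is recolored from
-- its start: whenever two colors are available for the arc entering a vertex, at
-- least two colors are available for the arc leaving it, with that vertex
-- satisfied. At the end of the path this freedom avoids the only forbidden color.
module Submission where

open import Defs
open import Algebra.Bundles using (module CommutativeRing)
open import Data.Bool using (Bool; true; false; T; not; _∧_; _xor_; if_then_else_)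
import Data.Bool.Properties as Bool
open import Data.Bool.Properties using (T-≡; T?; ∧-zeroʳ; ∧-identityʳ; ∧-distribˡ-xor; not-involutive; not-distribˡ-xor; xor-assoc; xor-comm; xor-identityʳ; xor-inverseˡ)
open import Data.Empty using (⊥; ⊥-elim)
open import Data.Fin as Fin using (Fin; zero; suc; toℕ; fromℕ<; inject≤; punchIn; _↑ˡ_; _↑ʳ_)
open import Data.Fin.Patterns using (0F; 1F; 2F)
open import Data.Fin.Properties using (all?; any?; inject≤-injective; pigeonhole; punchInᵢ≢i; splitAt-↑ˡ; splitAt-↑ʳ)
open import Data.Fin.Subset using (Subset; _∈_; _⊂_; ⊤)
open import Data.Fin.Subset.Induction using (⊂-wellFounded)
open import Data.Fin.Subset.Properties using (_∈?_; nonempty?; ∈⊤)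
open import Data.List as List using (map; allFin; []; _∷_)
open import Data.List.Membership.Propositional using () renaming (_∈_ to _∈ˡ_)
open import Data.List.Membership.Propositional.Properties using (∈-allFin)
open import Data.List.Properties using (map-tabulate)
open import Data.List.Relation.Unary.Any using (here; there)
open import Data.Nat using (ℕ; zero; suc; _+_; _∸_; _≤_; _<_; z≤n; s≤s; z<s; s<s)
open import Data.Nat.GeneralisedArithmetic using (fold; fold-+)
open import Data.Nat.Induction using (<-wellFounded)
open import Data.Nat.ListAction using () renaming (sum to sumℕ)
open import Data.Nat.Properties using (n<1+n; +-comm; m≤n⇒∃[o]m+o≡n; <-trans; <-irrefl; <⇒≤; ∸-monoʳ-<)
open import Data.Product using (∃; ∃₂; _×_; _,_; proj₁; proj₂)
open import Data.Sum using (_⊎_; inj₁; inj₂; map₁)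
open import Data.Unit using (tt)
open import Data.Vec as Vec using (Vec; []; _∷_; lookup)
open import Data.Vec.Functional using (removeAt)
open import Data.Vec.Properties using (lookup⇒[]=; []=⇒lookup; lookup∘tabulate)
open import Function using (_∘_; const; flip)
open import Function.Bundles using (_⇔_; mk⇔; module Equivalence)
open import Induction.WellFounded using (Acc; acc)
open import Level using (0ℓ)
open import Relation.Binary.PropositionalEquality using (_≡_; _≢_; refl; sym; trans; cong; cong₂; subst; module ≡-Reasoning)
open import Relation.Nullary using (Dec; yes; no; ¬_; contradiction)
open import Relation.Nullary.Decidable using (⌊_⌋; does; _×-dec_; _⊎-dec_; ¬?; dec-true; from-yes; map′)
open import Relation.Unary using (Pred; Decidable)

open import Algebra.Properties.Semiring.Sum (CommutativeRing.semiring Bool.xor-∧-commutativeRing)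
  using (sum; sum-cong-≗; sum-remove; sum-replicate-zero; ∑-comm; ∑-distrib-+; *-distribˡ-sum; *-distribʳ-sum)

open Equivalence using (to; from)

-- Parities and sums over the two-element field.

odd : ℕ → Bool
odd zero    = false
odd (suc m) = not (odd m)

odd-+ : ∀ m n → odd (m + n) ≡ odd m xor odd n
odd-+ zero    n = refl
odd-+ (suc m) n = trans (cong not (odd-+ m n)) (not-distribˡ-xor (odd m) (odd n))

odd⇒Odd : ∀ m → odd m ≡ true → Odd m
odd⇒Odd (suc zero)    _ = refl
odd⇒Odd (suc (suc m)) p = odd⇒Odd m (trans (sym (not² (odd m))) p)
  where
  not² : ∀ b → not (not b) ≡ b
  not² true  = refl
  not² false = refl

Odd⇒odd : ∀ m → Odd m → odd m ≡ true
Odd⇒odd (suc zero)    _ = refl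
Odd⇒odd (suc (suc m)) p = cong (not ∘ not) (Odd⇒odd m p)

δ : ∀ {n} → Fin n → Fin n → Bool
δ i j = ⌊ i Fin.≟ j ⌋

δ-refl : ∀ {n} (i : Fin n) → δ i i ≡ true
δ-refl i with i Fin.≟ i
... | yes _   = refl
... | no  i≢i = contradiction refl i≢i

δ-≢ : ∀ {n} {i j : Fin n} → i ≢ j → δ i j ≡ false
δ-≢ {i = i} {j} i≢j with i Fin.≟ j
... | yes i≡j = contradiction i≡j i≢j
... | no  _   = refl

δ-≡ : ∀ {n} {i j : Fin n} → δ i j ≡ true → i ≡ j
δ-≡ {i = i} {j} p with i Fin.≟ j
... | yes i≡j = i≡j

-- Isolates the one arc of a semi-cut whose color is still free: the remaining terms form a fixed
-- parity.
rest : ∀ {n} → (Fin n → Bool) → Fin n → Bool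
rest {suc n} f i = sum (removeAt f i)

sum-rest : ∀ {n} (f : Fin n → Bool) i → sum f ≡ rest f i xor f i
sum-rest {suc n} f i = trans (sum-remove f) (xor-comm (f i) _)

rest-cong : ∀ {n} {f g : Fin n → Bool} i → (∀ j → j ≢ i → f j ≡ g j) → rest f i ≡ rest g i
rest-cong {suc n} i f≗g = sum-cong-≗ (λ j → f≗g (punchIn i j) (punchInᵢ≢i i j))

sum-single : ∀ {n} (f : Fin n → Bool) i → (∀ j → j ≢ i → f j ≡ false) → sum f ≡ f i
sum-single {suc n} f i f≗0 = begin
  sum f               ≡⟨ sum-rest f i ⟩
  rest f i xor f i    ≡⟨ cong (_xor f i) (rest-cong {g = const false} i f≗0) ⟩
  sum {n} (const false) xor f i ≡⟨ cong (_xor f i) (sum-replicate-zero n) ⟩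
  f i                 ∎
  where open ≡-Reasoning

sum-δ : ∀ {n} (i : Fin n) (f : Fin n → Bool) → sum (λ j → δ i j ∧ f j) ≡ f i
sum-δ i f = trans (sum-single _ i (λ j j≢i → cong (_∧ f j) (δ-≢ (j≢i ∘ sym)))) (cong (_∧ f i) (δ-refl i))

-- The bridge from counting to linear algebra: `sumℕ` adds naturals, while `sum` adds in the field
-- with operations `_xor_` and `_∧_`, where the sum laws act on parities directly.
odd-sum : ∀ {n} (f : Fin n → ℕ) → odd (sumℕ (map f (allFin n))) ≡ sum (odd ∘ f)
odd-sum {n} f = trans (cong (odd ∘ sumℕ) (map-tabulate {n = n} (λ i → i) f)) (go f)
  where
  go : ∀ {n} (f : Fin n → ℕ) → odd (sumℕ (List.tabulate f)) ≡ sum (odd ∘ f)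
  go {zero}  f = refl
  go {suc n} f = trans (odd-+ (f zero) _) (cong (odd (f zero) xor_) (go (f ∘ suc)))

-- Condition (WO) in terms of parities.

bit : ∀ {k} (b : Bool) → (T b → Fin k) → Fin k → Bool
bit false f i = false
bit true  f i = δ (f tt) i

odd-ind : ∀ {k} b (f : T b → Fin k) i → odd (ind b f i) ≡ bit b f i
odd-ind false f i = refl
odd-ind true  f i with ⌊ f tt Fin.≟ i ⌋
... | true  = refl
... | false = refl

bit-const : ∀ {k} b {c i : Fin k} → bit b (const c) i ≡ b ∧ δ c i
bit-const false = refl
bit-const true  = refl

outParity inParity : ∀ {k} (D : Digraph) → (Arc D → Fin k) → Fin (n D) → Fin k → Bool
outParity D φ v i = sum (λ w → bit (adj D v w) (λ t → φ ((v , w) , t)) i)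
inParity  D φ v i = sum (λ w → bit (adj D w v) (λ t → φ ((w , v) , t)) i)

-- Isolated vertices get no alternative of their own: both implications are vacuous there, for any
-- color.
OddAt : ∀ {k} (D : Digraph) → (Arc D → Fin k) → Fin (n D) → Fin k → Set
OddAt D φ v i = (OutNonempty D v → outParity D φ v i ≡ true)
              × (InNonempty  D v → inParity  D φ v i ≡ true)

count-odd : ∀ {n k} (b : Fin n → Bool) (f : ∀ w → T (b w) → Fin k) i →
            Odd (sumℕ (map (λ w → ind (b w) (f w) i) (allFin n))) ⇔
            sum (λ w → bit (b w) (f w) i) ≡ true
count-odd {n} b f i = mk⇔ (λ o → trans (sym parity) (Odd⇒odd count o)) (λ p → odd⇒Odd count (trans parity p))
  where
  count : ℕ
  count = sumℕ (map (λ w → ind (b w) (f w) i) (allFin n))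

  parity : odd count ≡ sum (λ w → bit (b w) (f w) i)
  parity = trans (odd-sum (λ w → ind (b w) (f w) i)) (sum-cong-≗ (λ w → odd-ind (b w) (f w) i))

outCount-odd : ∀ {k} D (φ : Arc D → Fin k) v i → Odd (outCount D φ v i) ⇔ outParity D φ v i ≡ true
outCount-odd D φ v = count-odd (λ w → adj D v w) (λ w t → φ ((v , w) , t))

inCount-odd : ∀ {k} D (φ : Arc D → Fin k) v i → Odd (inCount D φ v i) ⇔ inParity D φ v i ≡ true
inCount-odd D φ v = count-odd (λ w → adj D w v) (λ w t → φ ((w , v) , t))

OddAt⇒WO : ∀ {k} D (φ : Arc D → Fin k) {v} → ∃ (OddAt D φ v) → WO D φ v
OddAt⇒WO D φ {v} (i , out , inn) = inj₂ (i , from (outCount-odd D φ v i) ∘ out , from (inCount-odd D φ v i) ∘ inn)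

-- With no colour at all, (WO) at an isolated vertex yields no i, hence suc k.
WO⇒OddAt : ∀ {k} D (φ : Arc D → Fin (suc k)) {v} → WO D φ v → ∃ (OddAt D φ v)
WO⇒OddAt D φ (inj₁ (noOut , noIn)) = zero
  , (λ (w , t) → ⊥-elim (subst T (noOut w) t))
  , (λ (w , t) → ⊥-elim (subst T (noIn w) t))
WO⇒OddAt D φ {v} (inj₂ (i , out , inn)) = i , to (outCount-odd D φ v i) ∘ out , to (inCount-odd D φ v i) ∘ inn

-- The smaller palette embeds in the larger one; by injectivity each color class stays the same set
-- of arcs.
WOColorable-mono : ∀ D {j k} → j ≤ k → WOColorable D j → WOColorable D k
WOColorable-mono D {j} {k} j≤k (φ , wo) = φ′ , λ v → embed (wo v)
  where
  φ′ : Arc D → Fin k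
  φ′ a = inject≤ (φ a) j≤k

  δ-inject : ∀ (a i : Fin j) → δ (inject≤ a j≤k) (inject≤ i j≤k) ≡ δ a i
  δ-inject a i with a Fin.≟ i
  ... | yes refl = δ-refl (inject≤ a j≤k)
  ... | no  a≢i  = δ-≢ (a≢i ∘ inject≤-injective j≤k j≤k a i)

  bit-inject : ∀ b (f : T b → Fin j) i → bit b (λ t → inject≤ (f t) j≤k) (inject≤ i j≤k) ≡ bit b f i
  bit-inject false f i = refl
  bit-inject true  f i = δ-inject (f tt) i

  embed : ∀ {v} → WO D φ v → WO D φ′ v
  embed {v} (inj₁ isolated) = inj₁ isolated
  embed {v} (inj₂ (i , out , inn)) = OddAt⇒WO D φ′ (inject≤ i j≤k
    , (λ ne → trans (sum-cong-≗ (λ w → bit-inject (adj D v w) (λ t → φ ((v , w) , t)) i))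
                    (to (outCount-odd D φ v i) (out ne)))
    , (λ ne → trans (sum-cong-≗ (λ w → bit-inject (adj D w v) (λ t → φ ((w , v) , t)) i))
                    (to (inCount-odd D φ v i) (inn ne))))

-- Sums over blocks of odd size.

sum-const : ∀ m b → sum {m} (const b) ≡ odd m ∧ b
sum-const zero    b = refl
sum-const (suc m) b = trans (cong (b xor_) (sum-const m b)) (factor (odd m) b)
  where
  factor : ∀ o b → b xor (o ∧ b) ≡ not o ∧ b
  factor true  true  = refl
  factor true  false = refl
  factor false true  = refl
  factor false false = refl

sum-++ : ∀ m {n} (f : Fin (m + n) → Bool) → sum f ≡ sum (λ i → f (i ↑ˡ n)) xor sum (λ j → f (m ↑ʳ j))
sum-++ zero    f = refl
sum-++ (suc m) f = trans (cong (f zero xor_) (sum-++ m (f ∘ suc))) (sym (xor-assoc (f zero) _ _))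

owner-↑ˡ : ∀ {m} (s : Fin (suc m) → ℕ) i → owner s (i ↑ˡ total (s ∘ suc)) ≡ zero
owner-↑ˡ s i rewrite splitAt-↑ˡ (s zero) i (total (s ∘ suc)) = refl

owner-↑ʳ : ∀ {m} (s : Fin (suc m) → ℕ) j → owner s (s zero ↑ʳ j) ≡ suc (owner (s ∘ suc) j)
owner-↑ʳ s j rewrite splitAt-↑ʳ (s zero) (total (s ∘ suc)) j = refl

-- Block i contributes `s i` equal terms, and an odd number of equal terms is one term mod 2.
sum-owner : ∀ {m} (s : Fin m → ℕ) → (∀ i → odd (s i) ≡ true) →
            ∀ (f : Fin m → Bool) → sum (f ∘ owner s) ≡ sum f
sum-owner {zero}  s s-odd f = refl
sum-owner {suc m} s s-odd f = begin
  sum (f ∘ owner s)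
    ≡⟨ sum-++ (s zero) (f ∘ owner s) ⟩
  sum (λ i → f (owner s (i ↑ˡ total (s ∘ suc)))) xor sum (λ j → f (owner s (s zero ↑ʳ j)))
    ≡⟨ cong₂ _xor_ (trans (sum-cong-≗ (λ i → cong f (owner-↑ˡ s i)))
                          (trans (sum-const (s zero) (f zero)) (cong (_∧ f zero) (s-odd zero))))
                   (trans (sum-cong-≗ (λ j → cong f (owner-↑ʳ s j)))
                          (sum-owner (s ∘ suc) (s-odd ∘ suc) (f ∘ suc))) ⟩
  sum f ∎
  where open ≡-Reasoning

owner-surjective : ∀ {m} (s : Fin m → ℕ) → (∀ i → 1 ≤ s i) → ∀ i → ∃ λ x → owner s x ≡ i
owner-surjective s 1≤s zero = fromℕ< (1≤s zero) ↑ˡ _ , owner-↑ˡ s _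
owner-surjective s 1≤s (suc i) with owner-surjective (s ∘ suc) (1≤s ∘ suc) i
... | x , own = s zero ↑ʳ x , trans (owner-↑ʳ s x) (cong suc own)

-- Block sums of matrices and the choice between two colors.

sum-false : ∀ {n} {f : Fin n → Bool} → (∀ i → f i ≡ false) → sum f ≡ false
sum-false {n} f≗0 = trans (sum-cong-≗ f≗0) (sum-replicate-zero n)

sum-δʳ : ∀ {n} (i : Fin n) b → sum (λ j → δ j i ∧ b) ≡ b
sum-δʳ i b = trans (sum-single _ i (λ j j≢i → cong (_∧ b) (δ-≢ j≢i))) (cong (_∧ b) (δ-refl i))

δ-∧-cong : ∀ {n} {i j : Fin n} {a b} → (i ≡ j → a ≡ b) → δ i j ∧ a ≡ δ i j ∧ b
δ-∧-cong {i = i} {j} a≡b with i Fin.≟ j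
... | yes i≡j = a≡b i≡j
... | no  _   = refl

-- The block sums of the matrix `M` for the partition into fibres of `o`. When `M` marks the arcs of
-- one color, the entry at `i`, `j` is the parity of that color from I_i to I_j.
aggregate : ∀ {m n} → (Fin m → Fin n) → (Fin m → Fin m → Bool) → Fin n → Fin n → Bool
aggregate o M i j = sum (λ x → δ i (o x) ∧ sum (λ y → δ j (o y) ∧ M x y))

-- Each `y` lies in exactly one fibre, so summing over `j` lifts the restriction on `y`.
aggregate-row : ∀ {m n} (o : Fin m → Fin n) M i →
                sum (aggregate o M i) ≡ sum (λ x → δ i (o x) ∧ sum (M x))
aggregate-row {m} {n} o M i = begin
  sum (λ j → sum (λ x → δ i (o x) ∧ sum (λ y → δ j (o y) ∧ M x y)))
    ≡⟨ ∑-comm (λ j x → δ i (o x) ∧ sum (λ y → δ j (o y) ∧ M x y)) ⟩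
  sum (λ x → sum (λ j → δ i (o x) ∧ sum (λ y → δ j (o y) ∧ M x y)))
    ≡⟨ sum-cong-≗ (λ x → *-distribˡ-sum (δ i (o x)) (λ j → sum (λ y → δ j (o y) ∧ M x y))) ⟨
  sum (λ x → δ i (o x) ∧ sum (λ j → sum (λ y → δ j (o y) ∧ M x y)))
    ≡⟨ sum-cong-≗ (λ x → cong (δ i (o x) ∧_) (trans (∑-comm (λ j y → δ j (o y) ∧ M x y))
                                                   (sum-cong-≗ (λ y → sum-δʳ (o y) (M x y))))) ⟩
  sum (λ x → δ i (o x) ∧ sum (M x)) ∎
  where open ≡-Reasoning

-- Lets `aggregate-row` handle in-arcs as well, as columns of the matrix.
aggregate-flip : ∀ {m n} (o : Fin m → Fin n) M i j → aggregate o M i j ≡ aggregate o (flip M) j i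
aggregate-flip o M i j = begin
  sum (λ x → δ i (o x) ∧ sum (λ y → δ j (o y) ∧ M x y))
    ≡⟨ sum-cong-≗ (λ x → *-distribˡ-sum (δ i (o x)) (λ y → δ j (o y) ∧ M x y)) ⟩
  sum (λ x → sum (λ y → δ i (o x) ∧ (δ j (o y) ∧ M x y)))
    ≡⟨ ∑-comm (λ x y → δ i (o x) ∧ (δ j (o y) ∧ M x y)) ⟩
  sum (λ y → sum (λ x → δ i (o x) ∧ (δ j (o y) ∧ M x y)))
    ≡⟨ sum-cong-≗ (λ y → sum-cong-≗ (λ x → exchange (δ i (o x)) (δ j (o y)) (M x y))) ⟩
  sum (λ y → sum (λ x → δ j (o y) ∧ (δ i (o x) ∧ M x y)))
    ≡⟨ sum-cong-≗ (λ y → *-distribˡ-sum (δ j (o y)) (λ x → δ i (o x) ∧ M x y)) ⟨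
  sum (λ y → δ j (o y) ∧ sum (λ x → δ i (o x) ∧ M x y)) ∎
  where
  open ≡-Reasoning
  exchange : ∀ a b c → a ∧ (b ∧ c) ≡ b ∧ (a ∧ c)
  exchange true  b     c = refl
  exchange false true  c = refl
  exchange false false c = refl

-- Here `w` is the indicator of a block, and `c x` a color that satisfies (WO) at `x`.
module _ {m} (w : Fin m → Bool) (w-odd : sum w ≡ true) (c : Fin m → Fin 2) where

  weight : Fin 2 → Bool
  weight a = sum (λ x → w x ∧ δ (c x) a)

  -- The two weights add up to the odd number `sum w`, so one of them is odd.
  odd-weight : ∃ λ a → weight a ≡ true
  odd-weight with weight zero in eq
  ... | true  = zero , eq
  ... | false = suc zero , trans (cong (_xor weight (suc zero)) (sym eq)) (trans (sym total-weight) w-odd)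
    where
    split : ∀ b (a : Fin 2) → b ≡ (b ∧ δ a zero) xor (b ∧ δ a (suc zero))
    split false a          = refl
    split true  zero       = refl
    split true  (suc zero) = refl

    total-weight : sum w ≡ weight zero xor weight (suc zero)
    total-weight = trans (sum-cong-≗ (λ x → split (w x) (c x)))
                         (∑-distrib-+ (λ x → w x ∧ δ (c x) zero) (λ x → w x ∧ δ (c x) (suc zero)))

  -- An x with c x ≢ a has r a x = d + 1, and there is an even number of those.
  odd-weight⇒odd : ∀ {a} → weight a ≡ true → (r : Fin 2 → Fin m → Bool) (d : Bool) →
    (∀ x → w x ≡ true → r zero x xor r (suc zero) x ≡ d) →
    (∀ x → w x ≡ true → r (c x) x ≡ true) → sum (λ x → w x ∧ r a x) ≡ true
  odd-weight⇒odd {a} odd-a r d r-total r-odd = begin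
    sum (λ x → w x ∧ r a x)
      ≡⟨ sum-cong-≗ (λ x → term (w x) (c x) a (λ b → r b x) (r-total x) (r-odd x)) ⟩
    sum (λ x → (w x ∧ not d) xor ((w x ∧ δ (c x) a) ∧ d))
      ≡⟨ ∑-distrib-+ (λ x → w x ∧ not d) (λ x → (w x ∧ δ (c x) a) ∧ d) ⟩
    sum (λ x → w x ∧ not d) xor sum (λ x → (w x ∧ δ (c x) a) ∧ d)
      ≡⟨ cong₂ _xor_ (*-distribʳ-sum (not d) w) (*-distribʳ-sum d (λ x → w x ∧ δ (c x) a)) ⟨
    (sum w ∧ not d) xor (weight a ∧ d)
      ≡⟨ cong₂ (λ p q → (p ∧ not d) xor (q ∧ d)) w-odd odd-a ⟩
    not d xor d
      ≡⟨ xor-inverseˡ d ⟩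
    true ∎
    where
    open ≡-Reasoning
    term : ∀ b (e a : Fin 2) (r : Fin 2 → Bool) → (b ≡ true → r zero xor r (suc zero) ≡ d) →
           (b ≡ true → r e ≡ true) → b ∧ r a ≡ (b ∧ not d) xor ((b ∧ δ e a) ∧ d)
    term false e a r _ _ = refl
    term true e a r total r-e with total refl | r-e refl
    term true zero       zero       r total r-e | refl | p rewrite p = sym (xor-inverseˡ (not (r (suc zero))))
    term true zero       (suc zero) r total r-e | refl | p rewrite p | not-involutive (r (suc zero)) = sym (xor-identityʳ _)
    term true (suc zero) zero       r total r-e | refl | p rewrite p = lem (r zero)
      where
      lem : ∀ b → b ≡ not (b xor true) xor false
      lem true  = refl
      lem false = refl
    term true (suc zero) (suc zero) r total r-e | refl | p rewrite p = sym (xor-inverseˡ (r zero xor true))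

-- Transfer of colorings between a digraph and its extension, with at most two colors downwards.

module _ (D : Digraph) (s : Fin (n D) → ℕ) (s-odd : ∀ i → Odd (s i)) where

  private
    ED : Digraph
    ED = extended D s

    odd-s : ∀ i → odd (s i) ≡ true
    odd-s i = Odd⇒odd (s i) (s-odd i)

  -- Each arc at `owner s x` appears at `x` as an odd number of arcs of the same color, so all
  -- parities at `x` are those at its owner.
  colorable-extended : ∀ {k} → WOColorable D k → WOColorable ED k
  colorable-extended {k} (φ , wo) = ψ , λ x → lift (wo (owner s x))
    where
    ψ : Arc ED → Fin k
    ψ ((x , y) , t) = φ ((owner s x , owner s y) , t)

    lift : ∀ {x} → WO D φ (owner s x) → WO ED ψ x
    lift (inj₁ (noOut , noIn)) = inj₁ (noOut ∘ owner s , noIn ∘ owner s)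
    lift {x} (inj₂ (i , out , inn)) = OddAt⇒WO ED ψ (i
      , (λ (y , t) → trans (sum-owner s odd-s (λ w → bit (adj D v w) (λ t → φ ((v , w) , t)) i))
                           (to (outCount-odd D φ v i) (out (owner s y , t))))
      , (λ (y , t) → trans (sum-owner s odd-s (λ w → bit (adj D w v) (λ t → φ ((w , v) , t)) i))
                           (to (inCount-odd D φ v i) (inn (owner s y , t)))))
      where
      v : Fin (n D)
      v = owner s x

  module _ (1≤s : ∀ i → 1 ≤ s i) where

    private
      rep : ∀ i → ∃ λ x → owner s x ≡ i
      rep = owner-surjective s 1≤s

      out-lift : ∀ {x} → OutNonempty D (owner s x) → OutNonempty ED x
      out-lift {x} (w , t) with rep w
      ... | y , refl = y , t

      in-lift : ∀ {x} → InNonempty D (owner s x) → InNonempty ED x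
      in-lift {x} (w , t) with rep w
      ... | y , refl = y , t

    -- An arc of `D` would lift to an arc of `ED`, for which there is no color; so every vertex of
    -- `D` is isolated.
    colorable₀ : WOColorable ED 0 → WOColorable D 0
    colorable₀ (ψ , _) = ⊥-elim ∘ noArc , λ v → inj₁ ((λ w → noAdj v w) , (λ w → noAdj w v))
      where
      noArc : Arc D → ⊥
      noArc ((u , v) , t) with rep u | rep v
      ... | x , refl | y , refl with () ← ψ ((x , y) , t)

      noAdj : ∀ u v → adj D u v ≡ false
      noAdj u v with adj D u v in eq
      ... | false = refl
      ... | true  = ⊥-elim (noArc ((u , v) , from T-≡ eq))

    -- With a single color, (WO) says that nonempty semi-cuts have odd size, and degrees in `ED` and
    -- `D` agree mod 2.
    colorable₁ : WOColorable ED 1 → WOColorable D 1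
    colorable₁ (ψ , wo) = φ , λ v → descend v (rep v)
      where
      φ : Arc D → Fin 1
      φ _ = zero

      bit₁ : ∀ b (f : T b → Fin 1) i → bit b (λ _ → zero) i ≡ bit b f i
      bit₁ false f i = refl
      bit₁ true  f i with zero ← f tt = refl

      descend : ∀ v → (∃ λ x → owner s x ≡ v) → WO D φ v
      descend v (x , refl) with WO⇒OddAt ED ψ (wo x)
      ... | i , out , inn = OddAt⇒WO D φ (i
        , (λ ne → trans (sym (sum-owner s odd-s (λ w → bit (adj D v w) (λ _ → zero) i)))
                 (trans (sum-cong-≗ (λ y → bit₁ (adj ED x y) (λ t → ψ ((x , y) , t)) i)) (out (out-lift ne))))
        , (λ ne → trans (sym (sum-owner s odd-s (λ w → bit (adj D w v) (λ _ → zero) i)))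
                 (trans (sum-cong-≗ (λ y → bit₁ (adj ED y x) (λ t → ψ ((y , x) , t)) i)) (inn (in-lift ne)))))

    colorable₂ : WOColorable ED 2 → WOColorable D 2
    colorable₂ (ψ , wo) = φ , λ v → OddAt⇒WO D φ (descend v)
      where
      open ≡-Reasoning

      color : Fin 2 → Fin (total s) → Fin (total s) → Bool
      color a x y = bit (adj ED x y) (λ t → ψ ((x , y) , t)) a

      block : Fin 2 → Fin (n D) → Fin (n D) → Bool
      block a = aggregate (owner s) (color a)

      φ : Arc D → Fin 2
      φ ((i , j) , _) = if block zero i j then zero else suc zero

      color-total : ∀ x y → color zero x y xor color (suc zero) x y ≡ adj ED x y
      color-total x y = go (adj ED x y) (λ t → ψ ((x , y) , t))
        where
        go : ∀ b (f : T b → Fin 2) → bit b f zero xor bit b f (suc zero) ≡ b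
        go false f = refl
        go true  f with f tt
        ... | zero     = refl
        ... | suc zero = refl

      -- If v_i v_j is an arc, then s_i s_j arcs run from I_i to I_j, an odd number, so exactly one
      -- of the two colors is odd there; otherwise there are none.
      block-total : ∀ i j → block zero i j xor block (suc zero) i j ≡ adj D i j
      block-total i j = begin
        block zero i j xor block (suc zero) i j
          ≡⟨ ∑-distrib-+ (λ x → δ i (owner s x) ∧ sum (λ y → δ j (owner s y) ∧ color zero x y))
                         (λ x → δ i (owner s x) ∧ sum (λ y → δ j (owner s y) ∧ color (suc zero) x y)) ⟨
        sum (λ x → (δ i (owner s x) ∧ sum (λ y → δ j (owner s y) ∧ color zero x y)) xor
                   (δ i (owner s x) ∧ sum (λ y → δ j (owner s y) ∧ color (suc zero) x y)))
          ≡⟨ sum-cong-≗ (λ x → trans (sym (∧-distribˡ-xor (δ i (owner s x)) _ _)) (cong (δ i (owner s x) ∧_) (row x))) ⟩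
        sum (λ x → δ i (owner s x) ∧ adj D (owner s x) j)
          ≡⟨ sum-owner s odd-s (λ u → δ i u ∧ adj D u j) ⟩
        sum (λ u → δ i u ∧ adj D u j)
          ≡⟨ sum-δ i (λ u → adj D u j) ⟩
        adj D i j ∎
        where
        row : ∀ x → sum (λ y → δ j (owner s y) ∧ color zero x y) xor
                    sum (λ y → δ j (owner s y) ∧ color (suc zero) x y) ≡ adj D (owner s x) j
        row x = begin
          sum (λ y → δ j (owner s y) ∧ color zero x y) xor sum (λ y → δ j (owner s y) ∧ color (suc zero) x y)
            ≡⟨ ∑-distrib-+ (λ y → δ j (owner s y) ∧ color zero x y) (λ y → δ j (owner s y) ∧ color (suc zero) x y) ⟨
          sum (λ y → (δ j (owner s y) ∧ color zero x y) xor (δ j (owner s y) ∧ color (suc zero) x y))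
            ≡⟨ sum-cong-≗ (λ y → trans (sym (∧-distribˡ-xor (δ j (owner s y)) _ _)) (cong (δ j (owner s y) ∧_) (color-total x y))) ⟩
          sum (λ y → δ j (owner s y) ∧ adj D (owner s x) (owner s y))
            ≡⟨ sum-owner s odd-s (λ w → δ j w ∧ adj D (owner s x) w) ⟩
          sum (λ w → δ j w ∧ adj D (owner s x) w)
            ≡⟨ sum-δ j (adj D (owner s x)) ⟩
          adj D (owner s x) j ∎

      block-empty : ∀ a i j → adj D i j ≡ false → block a i j ≡ false
      block-empty a i j none = sum-false λ x → trans
        (δ-∧-cong {i = i} {owner s x} {b = false} λ { refl → sum-false λ y → trans
          (δ-∧-cong {i = j} {owner s y} {b = false} λ { refl → empty (adj ED x y) (λ t → ψ ((x , y) , t)) none })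
          (∧-zeroʳ (δ j (owner s y))) })
        (∧-zeroʳ (δ i (owner s x)))
        where
        empty : ∀ b (f : T b → Fin 2) → b ≡ false → bit b f a ≡ false
        empty false f _ = refl

      -- Thus the color classes of `φ` are the matrices `block a`, and parities at a vertex of `D`
      -- become row and column sums of block sums.
      bit-block : ∀ a i j → bit (adj D i j) (λ t → φ ((i , j) , t)) a ≡ block a i j
      bit-block a i j = go (adj D i j) (λ b → block b i j) a (block-total i j) (block-empty zero i j)
        where
        go : ∀ b (r : Fin 2 → Bool) a → r zero xor r (suc zero) ≡ b → (b ≡ false → r zero ≡ false) →
             bit b (λ _ → if r zero then zero else suc zero) a ≡ r a
        go false r zero       _     none = sym (none refl)
        go false r (suc zero) total none = trans (sym total) (cong (_xor r (suc zero)) (none refl))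
        go true  r zero       _     _ with r zero
        ... | true  = refl
        ... | false = refl
        go true  r (suc zero) total _ with r zero | r (suc zero)
        ... | true  | false = refl
        ... | false | true  = refl

      descend : ∀ v → ∃ (OddAt D φ v)
      descend v = a , outOdd , inOdd
        where
        inBlock : Fin (total s) → Bool
        inBlock x = δ v (owner s x)

        inBlock-odd : sum inBlock ≡ true
        inBlock-odd = trans (sum-owner s odd-s (δ v))
          (trans (sum-cong-≗ (λ u → sym (∧-identityʳ (δ v u)))) (sum-δ v (const true)))

        good : ∀ x → ∃ (OddAt ED ψ x)
        good x = WO⇒OddAt ED ψ (wo x)

        chosen : ∃ λ a → weight inBlock inBlock-odd (proj₁ ∘ good) a ≡ true
        chosen = odd-weight inBlock inBlock-odd (proj₁ ∘ good)

        -- The choice depends on the colors of the vertices in the block and not on a direction, so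
        -- the same `a` serves both semi-cuts of `v`.
        a : Fin 2
        a = proj₁ chosen

        outOdd : OutNonempty D v → outParity D φ v a ≡ true
        outOdd ne = begin
          outParity D φ v a                          ≡⟨ sum-cong-≗ (bit-block a v) ⟩
          sum (block a v)                            ≡⟨ aggregate-row (owner s) (color a) v ⟩
          sum (λ x → inBlock x ∧ sum (color a x))    ≡⟨ odd-weight⇒odd inBlock inBlock-odd (proj₁ ∘ good) (proj₂ chosen)
                                                          (λ b x → sum (color b x)) (sum (adj D v)) degree odd-color ⟩
          true                                       ∎
          where
          degree : ∀ x → inBlock x ≡ true → sum (color zero x) xor sum (color (suc zero) x) ≡ sum (adj D v)
          degree x x∈I with refl ← δ-≡ {i = v} x∈I = begin
            sum (color zero x) xor sum (color (suc zero) x)        ≡⟨ ∑-distrib-+ (color zero x) (color (suc zero) x) ⟨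
            sum (λ y → color zero x y xor color (suc zero) x y)    ≡⟨ sum-cong-≗ (color-total x) ⟩
            sum (adj ED x)                                         ≡⟨ sum-owner s odd-s (adj D (owner s x)) ⟩
            sum (adj D (owner s x))                                ∎

          odd-color : ∀ x → inBlock x ≡ true → sum (color (proj₁ (good x)) x) ≡ true
          odd-color x x∈I with refl ← δ-≡ {i = v} x∈I = proj₁ (proj₂ (good x)) (out-lift ne)

        inOdd : InNonempty D v → inParity D φ v a ≡ true
        inOdd ne = begin
          inParity D φ v a
            ≡⟨ sum-cong-≗ (λ u → trans (bit-block a u v) (aggregate-flip (owner s) (color a) u v)) ⟩
          sum (aggregate (owner s) (flip (color a)) v)
            ≡⟨ aggregate-row (owner s) (flip (color a)) v ⟩
          sum (λ x → inBlock x ∧ sum (λ y → color a y x))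
            ≡⟨ odd-weight⇒odd inBlock inBlock-odd (proj₁ ∘ good) (proj₂ chosen)
                 (λ b x → sum (λ y → color b y x)) (sum (λ u → adj D u v)) degree odd-color ⟩
          true ∎
          where
          degree : ∀ x → inBlock x ≡ true →
                   sum (λ y → color zero y x) xor sum (λ y → color (suc zero) y x) ≡ sum (λ u → adj D u v)
          degree x x∈I with refl ← δ-≡ {i = v} x∈I = begin
            sum (λ y → color zero y x) xor sum (λ y → color (suc zero) y x)
              ≡⟨ ∑-distrib-+ (λ y → color zero y x) (λ y → color (suc zero) y x) ⟨
            sum (λ y → color zero y x xor color (suc zero) y x)
              ≡⟨ sum-cong-≗ (λ y → color-total y x) ⟩
            sum (λ y → adj ED y x)
              ≡⟨ sum-owner s odd-s (λ u → adj D u (owner s x)) ⟩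
            sum (λ u → adj D u (owner s x)) ∎

          odd-color : ∀ x → inBlock x ≡ true → sum (λ y → color (proj₁ (good x)) y x) ≡ true
          odd-color x x∈I with refl ← δ-≡ {i = v} x∈I = proj₂ (proj₂ (good x)) (in-lift ne)

-- Decidable subsets and periodic points of finite maps.

module _ {n} {P : Pred (Fin n) 0ℓ} (P? : Decidable P) where

  separate : Subset n
  separate = Vec.tabulate (does ∘ P?)

  ∈-separate⁺ : ∀ {x} → P x → x ∈ separate
  ∈-separate⁺ {x} p = lookup⇒[]= x separate (trans (lookup∘tabulate (does ∘ P?) x) (dec-true (P? x) p))

  ∈-separate⁻ : ∀ {x} → x ∈ separate → P x
  ∈-separate⁻ {x} x∈ with P? x | trans (sym (lookup∘tabulate (does ∘ P?) x)) ([]=⇒lookup x∈)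
  ... | yes p | _ = p

fold-comm : ∀ {A : Set} (f : A → A) k z → fold (f z) f k ≡ f (fold z f k)
fold-comm f zero    z = refl
fold-comm f (suc k) z = cong f (fold-comm f k z)

-- Among the first n + 1 iterates two coincide; their distance is written `suc q` to keep the period
-- positive.
periodic-point : ∀ {n} (f : Fin n → Fin n) x → ∃ λ i → ∃ λ q → let y = fold x f i in fold y f (suc q) ≡ y
periodic-point {n} f x with pigeonhole (n<1+n n) (λ k → fold x f (toℕ k))
... | i , j , i<j , eq with m≤n⇒∃[o]m+o≡n i<j
...   | q , i+q≡j = toℕ i , q , (begin
  fold (fold x f (toℕ i)) f (suc q) ≡⟨ fold-+ x f (suc q) ⟨
  fold x f (suc q + toℕ i)          ≡⟨ cong (fold x f ∘ suc) (+-comm q (toℕ i)) ⟩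
  fold x f (suc (toℕ i) + q)        ≡⟨ cong (fold x f) i+q≡j ⟩
  fold x f (toℕ j)                  ≡⟨ eq ⟨
  fold x f (toℕ i)                  ∎)
  where open ≡-Reasoning

-- Disjoint directed cycles whose removal leaves an acyclic digraph.

module Cycles (D : Digraph) where

  private
    V : Set
    V = Fin (n D)

  -- On the vertices marked by `F`, `next` is a permutation with inverse `prev`, and its orbits are
  -- the cycles. Acyclicity is encoded by `rank`: every arc inside `W` with its tail off the cycles
  -- goes down, even when its head is on a cycle. The `bound` makes walks against the arcs terminate
  -- too.
  record CycleCover (W : Subset (n D)) : Set where
    field
      F         : V → Bool
      next prev : V → V
      F⊆W       : ∀ {x} → F x ≡ true → x ∈ W
      F-next    : ∀ {x} → F x ≡ true → F (next x) ≡ true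
      F-prev    : ∀ {x} → F x ≡ true → F (prev x) ≡ true
      next-arc  : ∀ {x} → F x ≡ true → T (adj D x (next x))
      next-prev : ∀ {x} → F x ≡ true → next (prev x) ≡ x
      prev-next : ∀ {x} → F x ≡ true → prev (next x) ≡ x
      rank      : V → ℕ
      bound     : ℕ
      rank<     : ∀ x → rank x < bound
      descent   : ∀ {u w} → u ∈ W → w ∈ W → F u ≡ false → T (adj D u w) → rank w < rank u

  module _ (W : Subset (n D)) where

    module _ {Q : Pred V 0ℓ} (Q? : Decidable Q) where

      private
        W∖Q? : Decidable (λ x → x ∈ W × ¬ Q x)
        W∖Q? x = x ∈? W ×-dec ¬? (Q? x)

      without : Subset (n D)
      without = separate W∖Q?

      ∈-without⁺ : ∀ {x} → x ∈ W → ¬ Q x → x ∈ without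
      ∈-without⁺ x∈W x∉Q = ∈-separate⁺ W∖Q? (x∈W , x∉Q)

      ∈-without⁻ : ∀ {x} → x ∈ without → x ∈ W × ¬ Q x
      ∈-without⁻ = ∈-separate⁻ W∖Q?

      without-⊂ : ∃ (λ x → x ∈ W × Q x) → without ⊂ W
      without-⊂ (x , x∈W , q) = (λ y∈ → proj₁ (∈-without⁻ y∈)) , x , x∈W , λ x∈ → proj₂ (∈-without⁻ x∈) q

    module _ {Q : Pred V 0ℓ} (Q? : Decidable Q) (C : CycleCover (without Q?)) where
      open CycleCover C

      -- The removed vertices go to the bottom and all others move up by one, so arcs into `Q`
      -- descend automatically.
      rank′ : V → ℕ
      rank′ x = if ⌊ Q? x ⌋ then 0 else suc (rank x)

      rank′< : ∀ x → rank′ x < suc bound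
      rank′< x with Q? x
      ... | yes _ = z<s
      ... | no  _ = s<s (rank< x)

      descent′ : ∀ {u w} → u ∈ W → w ∈ W → ¬ Q u → F u ≡ false → T (adj D u w) → rank′ w < rank′ u
      descent′ {u} {w} u∈W w∈W u∉Q u∉F arc with Q? u | Q? w
      ... | yes u∈Q | _       = contradiction u∈Q u∉Q
      ... | no  _   | yes _   = z<s
      ... | no  _   | no  w∉Q = s<s (descent (∈-without⁺ Q? u∈W u∉Q) (∈-without⁺ Q? w∈W w∉Q) u∉F arc)

    -- At rank 0 the vertex `u` could only violate `descent` as a tail, and no arc leaves it inside
    -- `W`.
    addSink : ∀ u → (∀ w → w ∈ W → ¬ T (adj D u w)) → CycleCover (without (Fin._≟ u)) → CycleCover W
    addSink u sink C = record
      { CycleCover C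
      ; F⊆W     = λ x∈F → proj₁ (∈-without⁻ (Fin._≟ u) (F⊆W x∈F))
      ; rank    = rank′ (Fin._≟ u) C
      ; bound   = suc bound
      ; rank<   = rank′< (Fin._≟ u) C
      ; descent = λ {v} {w} v∈W w∈W v∉F arc →
          descent′ (Fin._≟ u) C v∈W w∈W (λ { refl → sink w w∈W arc }) v∉F arc
      }
      where open CycleCover C

    module _ (f : V → V) (f∈W : ∀ {x} → x ∈ W → f x ∈ W) (f-arc : ∀ {x} → x ∈ W → T (adj D x (f x))) (q : ℕ) where

      -- The map `f` need not be injective on `W`, but on the points fixed by its power `suc q` it
      -- is a permutation with inverse `fold x f q`. These points therefore split into disjoint
      -- directed cycles.
      Periodic : Pred V 0ℓ
      Periodic x = x ∈ W × fold x f (suc q) ≡ x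

      Periodic? : Decidable Periodic
      Periodic? x = x ∈? W ×-dec fold x f (suc q) Fin.≟ x

      fold∈W : ∀ k {x} → x ∈ W → fold x f k ∈ W
      fold∈W zero    x∈W = x∈W
      fold∈W (suc k) x∈W = f∈W (fold∈W k x∈W)

      Periodic-f : ∀ {x} → Periodic x → Periodic (f x)
      Periodic-f {x} (x∈W , per) = f∈W x∈W , trans (fold-comm f (suc q) x) (cong f per)

      Periodic-fold : ∀ k {x} → Periodic x → Periodic (fold x f k)
      Periodic-fold zero    per = per
      Periodic-fold (suc k) per = Periodic-f (Periodic-fold k per)

      module _ (C : CycleCover (without Periodic?)) where
        open CycleCover C

        private
          F′ : V → Bool
          F′ x = if ⌊ Periodic? x ⌋ then true else F x

          next′ prev′ : V → V
          next′ x = if ⌊ Periodic? x ⌋ then f x else next x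
          prev′ x = if ⌊ Periodic? x ⌋ then fold x f q else prev x

          ¬Periodic : ∀ {x} → F x ≡ true → ¬ Periodic x
          ¬Periodic x∈F = proj₂ (∈-without⁻ Periodic? (F⊆W x∈F))

          data Membership (x : V) : Set where
            old : ¬ Periodic x → F x ≡ true → Membership x
            new : Periodic x → Membership x

          membership : ∀ {x} → F′ x ≡ true → Membership x
          membership {x} x∈F with Periodic? x
          ... | yes p = new p
          ... | no ¬p = old ¬p x∈F

          at-new : ∀ {A : Set} {a b : A} {x} → Periodic x → (if ⌊ Periodic? x ⌋ then a else b) ≡ a
          at-new {x = x} p with Periodic? x
          ... | yes _ = refl
          ... | no ¬p = contradiction p ¬p

          at-old : ∀ {A : Set} {a b : A} {x} → ¬ Periodic x → (if ⌊ Periodic? x ⌋ then a else b) ≡ b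
          at-old {x = x} ¬p with Periodic? x
          ... | yes p = contradiction p ¬p
          ... | no  _ = refl

          F′-old : ∀ {x} → F x ≡ true → F′ x ≡ true
          F′-old x∈F = trans (at-old (¬Periodic x∈F)) x∈F

        -- The earlier cycles avoid all periodic points, so they are disjoint from the new ones. The
        -- new cycle vertices may have rank 0, since `descent` asks nothing of tails on cycles.
        addCycles : CycleCover W
        addCycles = record
          { F         = F′
          ; next      = next′
          ; prev      = prev′
          ; F⊆W       = λ x∈F → F⊆W′ (membership x∈F)
          ; F-next    = λ x∈F → F-next′ (membership x∈F)
          ; F-prev    = λ x∈F → F-prev′ (membership x∈F)
          ; next-arc  = λ x∈F → next-arc′ (membership x∈F)
          ; next-prev = λ x∈F → next-prev′ (membership x∈F)
          ; prev-next = λ x∈F → prev-next′ (membership x∈F)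
          ; rank      = rank′ Periodic? C
          ; bound     = suc bound
          ; rank<     = rank′< Periodic? C
          ; descent   = λ {u} u∈W w∈W u∉F arc → descent-new u∈W w∈W u∉F arc
          }
          where
          F⊆W′ : ∀ {x} → Membership x → x ∈ W
          F⊆W′ (old _ x∈F) = proj₁ (∈-without⁻ Periodic? (F⊆W x∈F))
          F⊆W′ (new p)     = proj₁ p

          F-next′ : ∀ {x} → Membership x → F′ (next′ x) ≡ true
          F-next′ (old ¬p x∈F) = trans (cong F′ (at-old ¬p)) (F′-old (F-next x∈F))
          F-next′ (new p)      = trans (cong F′ (at-new p)) (at-new (Periodic-f p))

          F-prev′ : ∀ {x} → Membership x → F′ (prev′ x) ≡ true
          F-prev′ (old ¬p x∈F) = trans (cong F′ (at-old ¬p)) (F′-old (F-prev x∈F))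
          F-prev′ (new p)      = trans (cong F′ (at-new p)) (at-new (Periodic-fold q p))

          next-arc′ : ∀ {x} → Membership x → T (adj D x (next′ x))
          next-arc′ {x} (old ¬p x∈F) = subst (T ∘ adj D x) (sym (at-old ¬p)) (next-arc x∈F)
          next-arc′ {x} (new p)      = subst (T ∘ adj D x) (sym (at-new p)) (f-arc (proj₁ p))

          next-prev′ : ∀ {x} → Membership x → next′ (prev′ x) ≡ x
          next-prev′ (old ¬p x∈F) = trans (cong next′ (at-old ¬p)) (trans (at-old (¬Periodic (F-prev x∈F))) (next-prev x∈F))
          next-prev′ (new p)      = trans (cong next′ (at-new p)) (trans (at-new (Periodic-fold q p)) (proj₂ p))

          prev-next′ : ∀ {x} → Membership x → prev′ (next′ x) ≡ x
          prev-next′ (old ¬p x∈F) = trans (cong prev′ (at-old ¬p)) (trans (at-old (¬Periodic (F-next x∈F))) (prev-next x∈F))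
          prev-next′ {x} (new p)  = trans (cong prev′ (at-new p))
            (trans (at-new (Periodic-f p)) (trans (fold-comm f q x) (proj₂ p)))

          descent-new : ∀ {u w} → u ∈ W → w ∈ W → F′ u ≡ false → T (adj D u w) →
                        rank′ Periodic? C w < rank′ Periodic? C u
          descent-new {u} u∈W w∈W u∉F arc = descent′ Periodic? C u∈W w∈W ¬p (trans (sym (at-old ¬p)) u∉F) arc
            where
            ¬p : ¬ Periodic u
            ¬p p with () ← trans (sym (at-new p)) u∉F

  -- Either some vertex has no out-neighbor within `W` and is split off as a sink, or choosing an
  -- out-neighbor everywhere gives a self-map of `W`, whose nonempty set of periodic points is split
  -- off as cycles.
  cycleCover : ∀ W → Acc _⊂_ W → CycleCover W
  cycleCover W (acc smaller) with nonempty? W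
  ... | no empty = record
    { F = const false ; next = λ x → x ; prev = λ x → x
    ; F⊆W = λ () ; F-next = λ () ; F-prev = λ () ; next-arc = λ () ; next-prev = λ () ; prev-next = λ ()
    ; rank = const 0 ; bound = 1 ; rank< = λ _ → z<s
    ; descent = λ u∈W → contradiction (_ , u∈W) empty }
  ... | yes (x , x∈W) with any? (λ u → u ∈? W ×-dec ¬? (any? (λ w → w ∈? W ×-dec T? (adj D u w))))
  ...   | yes (u , u∈W , sink) = addSink W u (λ w w∈W arc → sink (w , w∈W , arc))
            (cycleCover _ (smaller (without-⊂ W (Fin._≟ u) (u , u∈W , refl))))
  ...   | no noSink = addCycles W f (proj₁ ∘ f-spec) (proj₂ ∘ f-spec) q
            (cycleCover _ (smaller (without-⊂ W (Periodic? W f (proj₁ ∘ f-spec) (proj₂ ∘ f-spec) q)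
              (fold x f i , y∈W , y∈W , periodic))))
    where
    successor : ∀ u → Dec (∃ λ w → w ∈ W × T (adj D u w))
    successor u = any? (λ w → w ∈? W ×-dec T? (adj D u w))

    f : V → V
    f u with successor u
    ... | yes (w , _) = w
    -- A dummy value: by `noSink` this case does not occur for `u` in `W`.
    ... | no  _       = u

    f-spec : ∀ {u} → u ∈ W → f u ∈ W × T (adj D u (f u))
    f-spec {u} u∈W with successor u
    ... | yes (_ , spec) = spec
    ... | no  sink       = contradiction (u , u∈W , sink) noSink

    i q : ℕ
    i = proj₁ (periodic-point f x)
    q = proj₁ (proj₂ (periodic-point f x))

    periodic : fold (fold x f i) f (suc q) ≡ fold x f i
    periodic = proj₂ (proj₂ (periodic-point f x))

    y∈W : fold x f i ∈ W
    y∈W = fold∈W W f (proj₁ ∘ f-spec) (proj₂ ∘ f-spec) q i x∈W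

-- Passing a choice of two colors through a vertex.

-- a and b are the color parities of the in- and out-arcs of a vertex, except for one in-arc of color y
-- and one out-arc of color z.
Meets : (a b : Fin 3 → Bool) → Fin 3 → Fin 3 → Set
Meets a b y z = ∃ λ i → a i xor δ y i ≡ true × b i xor δ z i ≡ true

Transfers : (a b : Fin 3 → Bool) → Fin 3 → Fin 3 → Set
Transfers a b y₀ y₁ = y₀ ≡ y₁ ⊎ ∃₂ λ z₀ z₁ →
  z₀ ≢ z₁ × (Meets a b y₀ z₀ ⊎ Meets a b y₁ z₀) × (Meets a b y₀ z₁ ⊎ Meets a b y₁ z₁)

meets? : ∀ a b y z → Dec (Meets a b y z)
meets? a b y z = any? (λ i → (a i xor δ y i) Bool.≟ true ×-dec (b i xor δ z i) Bool.≟ true)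

transfers? : ∀ a b y₀ y₁ → Dec (Transfers a b y₀ y₁)
transfers? a b y₀ y₁ = y₀ Fin.≟ y₁ ⊎-dec any? (λ z₀ → any? (λ z₁ →
  ¬? (z₀ Fin.≟ z₁) ×-dec (meets? a b y₀ z₀ ⊎-dec meets? a b y₁ z₀) ×-dec (meets? a b y₀ z₁ ⊎-dec meets? a b y₁ z₁)))

allVec? : ∀ {n} {P : Vec Bool n → Set} → (∀ v → Dec (P v)) → Dec (∀ v → P v)
allVec? {zero}  P? = map′ (λ { p [] → p }) (λ p → p []) (P? [])
allVec? {suc n} P? = map′ (λ { (p , q) (true ∷ v) → p v ; (p , q) (false ∷ v) → q v })
                          (λ p → (p ∘ (true ∷_)) , (p ∘ (false ∷_)))
                          (allVec? (P? ∘ (true ∷_)) ×-dec allVec? (P? ∘ (false ∷_)))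

abstract
  -- Verified by running through all cases. The reason: the in-colors that are odd for `y₀` or for
  -- `y₁` include both `y₀` and `y₁`, so at most one color c is missing. A color z fails only if `b`
  -- flipped at z is empty or {c}; the parity of the size of `b` decides which of these can occur,
  -- and then z is determined. So at most one of the three colors fails.
  transfers : ∀ (a b : Vec Bool 3) y₀ y₁ → Transfers (lookup a) (lookup b) y₀ y₁
  transfers = from-yes (allVec? λ a → allVec? λ b → all? λ y₀ → all? λ y₁ → transfers? (lookup a) (lookup b) y₀ y₁)

meets-tabulate : ∀ a b {y z} → Meets (lookup (Vec.tabulate a)) (lookup (Vec.tabulate b)) y z → Meets a b y z
meets-tabulate a b (i , p , q) rewrite lookup∘tabulate a i | lookup∘tabulate b i = i , p , q

-- The form used along a path: `c` names an alternative for the leaving arc, and `j` the alternative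
-- for the entering arc to be kept with it.
transfer : ∀ (a b : Fin 3 → Bool) (y : Bool → Fin 3) → y false ≢ y true →
           ∃ λ (z : Bool → Fin 3) → z false ≢ z true × ∀ c → ∃ λ j → Meets a b (y j) (z c)
transfer a b y y₀≢y₁ with transfers (Vec.tabulate a) (Vec.tabulate b) (y false) (y true)
... | inj₁ y₀≡y₁ = contradiction y₀≡y₁ y₀≢y₁
... | inj₂ (z₀ , z₁ , z₀≢z₁ , m₀ , m₁) =
  (λ c → if c then z₁ else z₀) , z₀≢z₁ , λ { false → choose m₀ ; true → choose m₁ }
  where
  choose : ∀ {z} → Meets (lookup (Vec.tabulate a)) (lookup (Vec.tabulate b)) (y false) z
                 ⊎ Meets (lookup (Vec.tabulate a)) (lookup (Vec.tabulate b)) (y true) z → ∃ λ j → Meets a b (y j) z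
  choose (inj₁ m) = false , meets-tabulate a b m
  choose (inj₂ m) = true , meets-tabulate a b m

-- A weak-odd 3-edge coloring of an arbitrary digraph.

module ThreeColors (D : Digraph) (C : Cycles.CycleCover D ⊤) where

  open Cycles.CycleCover C

  private
    V : Set
    V = Fin (n D)

  -- Total on pairs of vertices, so that recoloring carries no adjacency proofs; `hit` masks the
  -- values off the arcs.
  Coloring : Set
  Coloring = V → V → Fin 3

  hit : Coloring → Fin 3 → V → V → Bool
  hit φ i x y = adj D x y ∧ δ (φ x y) i

  record Satisfied (φ : Coloring) (x : V) : Set where
    constructor satisfiedBy
    field
      color : Fin 3
      out   : OutNonempty D x → sum (hit φ color x) ≡ true
      inn   : InNonempty  D x → sum (λ w → hit φ color w x) ≡ true

  hit-cong : ∀ {φ ψ x y} i → (T (adj D x y) → φ x y ≡ ψ x y) → hit φ i x y ≡ hit ψ i x y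
  hit-cong {x = x} {y} i φ≗ψ with adj D x y
  ... | false = refl
  ... | true  = cong (λ c → δ c i) (φ≗ψ _)

  satisfied-cong : ∀ {φ ψ x} → (∀ y → φ x y ≡ ψ x y) → (∀ w → φ w x ≡ ψ w x) → Satisfied φ x → Satisfied ψ x
  satisfied-cong {φ} {ψ} row col (satisfiedBy i out inn) = satisfiedBy i
    (λ ne → trans (sum-cong-≗ (λ y → hit-cong {ψ} {φ} i (λ _ → sym (row y)))) (out ne))
    (λ ne → trans (sum-cong-≗ (λ w → hit-cong {ψ} {φ} i (λ _ → sym (col w)))) (inn ne))

  onCycle : V → V → Bool
  onCycle x y = F x ∧ δ (next x) y

  Valid : Coloring → Set
  Valid φ = ∀ {x y} → T (adj D x y) → F x ≡ true ⊎ F y ≡ true → δ (φ x y) 2F ≡ onCycle x y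

  onCycle-tail : ∀ {x} y → F x ≡ false → onCycle x y ≡ false
  onCycle-tail y x∉F = cong (_∧ _) x∉F

  onCycle-head : ∀ x {y} → F y ≡ false → onCycle x y ≡ false
  onCycle-head x {y} y∉F with F x in x∈F
  ... | false = refl
  ... | true  = δ-≢ λ { refl → contradiction (trans (sym (F-next x∈F)) y∉F) λ () }

  -- Color 2 appears once in each semi-cut of `x`: on the arc to `next x` and on the arc from
  -- `prev x`.
  F-satisfied : ∀ {φ} → Valid φ → ∀ {x} → F x ≡ true → Satisfied φ x
  F-satisfied {φ} valid {x} x∈F = satisfiedBy 2F (const out) (const inn)
    where
    open ≡-Reasoning

    hit-cycle : ∀ x y → F x ≡ true ⊎ F y ≡ true → hit φ 2F x y ≡ adj D x y ∧ onCycle x y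
    hit-cycle x y touch with adj D x y in arc
    ... | false = refl
    ... | true  = valid (from T-≡ arc) touch

    out : sum (hit φ 2F x) ≡ true
    out = begin
      sum (hit φ 2F x)                        ≡⟨ sum-cong-≗ (λ y → hit-cycle x y (inj₁ x∈F)) ⟩
      sum (λ y → adj D x y ∧ onCycle x y)     ≡⟨ sum-single _ (next x) elsewhere ⟩
      adj D x (next x) ∧ onCycle x (next x)   ≡⟨ cong₂ _∧_ (to T-≡ (next-arc x∈F)) (cong₂ _∧_ x∈F (δ-refl (next x))) ⟩
      true                                    ∎
      where
      elsewhere : ∀ y → y ≢ next x → adj D x y ∧ onCycle x y ≡ false
      elsewhere y y≢ = trans (cong (λ b → adj D x y ∧ (F x ∧ b)) (δ-≢ (y≢ ∘ sym)))
                             (trans (cong (adj D x y ∧_) (∧-zeroʳ (F x))) (∧-zeroʳ (adj D x y)))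

    inn : sum (λ w → hit φ 2F w x) ≡ true
    inn = begin
      sum (λ w → hit φ 2F w x)                ≡⟨ sum-cong-≗ (λ w → hit-cycle w x (inj₂ x∈F)) ⟩
      sum (λ w → adj D w x ∧ onCycle w x)     ≡⟨ sum-single _ (prev x) elsewhere ⟩
      adj D (prev x) x ∧ onCycle (prev x) x   ≡⟨ cong₂ _∧_ (to T-≡ (subst (T ∘ adj D (prev x)) (next-prev x∈F) (next-arc (F-prev x∈F))))
                                                   (cong₂ _∧_ (F-prev x∈F) (trans (cong (λ y → δ y x) (next-prev x∈F)) (δ-refl x))) ⟩
      true                                    ∎
      where
      elsewhere : ∀ w → w ≢ prev x → adj D w x ∧ onCycle w x ≡ false
      elsewhere w w≢ with F w in w∈F
      ... | false = ∧-zeroʳ (adj D w x)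
      ... | true  = trans (cong (adj D w x ∧_) (δ-≢ {i = next w} λ { refl → w≢ (sym (prev-next w∈F)) })) (∧-zeroʳ (adj D w x))

  recolor : Coloring → V → V → Fin 3 → Coloring
  recolor φ u w c x y = if ⌊ x Fin.≟ u ×-dec y Fin.≟ w ⌋ then c else φ x y

  recolor-at : ∀ φ u w c → recolor φ u w c u w ≡ c
  recolor-at φ u w c with u Fin.≟ u ×-dec w Fin.≟ w
  ... | yes _ = refl
  ... | no ¬p = contradiction (refl , refl) ¬p

  recolor-off : ∀ φ {u w} c {x y} → (x ≡ u → y ≢ w) → recolor φ u w c x y ≡ φ x y
  recolor-off φ {u} {w} c {x} {y} off with x Fin.≟ u ×-dec y Fin.≟ w
  ... | yes (x≡u , y≡w) = contradiction y≡w (off x≡u)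
  ... | no  _           = refl

  recolor-valid : ∀ {φ u w c} → Valid φ → (F u ≡ true ⊎ F w ≡ true → δ c 2F ≡ onCycle u w) → Valid (recolor φ u w c)
  recolor-valid {u = u} {w} valid valid-at {x} {y} arc touch with x Fin.≟ u ×-dec y Fin.≟ w
  ... | yes (refl , refl) = valid-at touch
  ... | no  _             = valid arc touch

  recolor-satisfied : ∀ {φ u w c x} → x ≢ u → x ≢ w → Satisfied φ x → Satisfied (recolor φ u w c) x
  recolor-satisfied {φ} {u} {w} {c} x≢u x≢w = satisfied-cong
    (λ y → sym (recolor-off φ c (λ x≡u → contradiction x≡u x≢u)))
    (λ v → sym (recolor-off φ c (λ _ → x≢w)))

  satisfied-∪ : ∀ {P : V → Set} {φ u} → (∀ {x} → x ≢ u → P x → Satisfied φ x) → Satisfied φ u →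
                ∀ {x} → P x ⊎ x ≡ u → Satisfied φ x
  satisfied-∪ others sat (inj₂ refl) = sat
  satisfied-∪ {P} {φ} {u} others sat {x} (inj₁ px) = go (x Fin.≟ u)
    where
    go : Dec (x ≡ u) → Satisfied φ x
    go (yes refl) = sat
    go (no x≢u)   = others x≢u px

  arc⇒≢ : ∀ {u w} → T (adj D u w) → u ≢ w
  arc⇒≢ {u} arc refl = subst T (loopless D u) arc

  descends : ∀ {u w} → F u ≡ false → T (adj D u w) → rank w < rank u
  descends = descent ∈⊤ ∈⊤

  Colored : (V → Set) → Set
  Colored P = ∃ λ φ → Valid φ × (∀ {x} → P x → Satisfied φ x)

  module _ (ψ : Bool → Coloring) (u : V) where

    -- Both colorings share the parities of the other in-arcs of `u`, so together they supply
    -- `transfer` with one `a` and two distinct values of `y`.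
    record Entry : Set where
      constructor entry
      field
        t      : V
        arc    : T (adj D t u)
        differ : ψ false t u ≢ ψ true t u
        agree  : ∀ {x} → x ≢ t → ∀ b c → ψ b x u ≡ ψ c x u

  -- The state of the recoloring when it reaches u: two recolorings of everything upstream.
  record Fork (P : V → Set) (u : V) : Set where
    field
      ψ         : Bool → Coloring
      valid     : ∀ b → Valid (ψ b)
      satisfied : ∀ b {x} → x ≢ u → P x → Satisfied (ψ b) x
      agree     : ∀ {x y} → rank y < rank u → ∀ b c → ψ b x y ≡ ψ c x y
      incoming  : ¬ InNonempty D u ⊎ Entry ψ u

  module _ {P : V → Set} {u : V} (u∉F : F u ≡ false) (S : Fork P u) where
    open Fork S

    in-sum : ∀ ((entry t _ _ _) : Entry ψ u) φ j i → (∀ x → φ x u ≡ ψ j x u) →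
             sum (λ x → hit φ i x u) ≡ rest (λ x → hit (ψ false) i x u) t xor δ (ψ j t u) i
    in-sum (entry t arc _ agree) φ j i φ≗ψ = trans (sum-rest (λ x → hit φ i x u) t) (cong₂ _xor_
      (rest-cong t (λ x x≢t → hit-cong {φ} {ψ false} i (λ _ → trans (φ≗ψ x) (agree x≢t j false))))
      (cong₂ _∧_ (to T-≡ arc) (cong (λ c → δ c i) (φ≗ψ t))))

    module _ {w : V} (arc : T (adj D u w)) where

      private
        outRest : Fin 3 → Bool
        outRest i = rest (hit (ψ false) i u) w

      column : ∀ j z x → recolor (ψ j) u w z x u ≡ ψ j x u
      column j z x = recolor-off (ψ j) z (λ _ → arc⇒≢ arc)

      -- Out-neighbors of `u` have smaller rank, where the two colorings of the fork agree; hence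
      -- `outRest` can be read off from `ψ false` whatever `j` is.
      out-sum : ∀ j z i → sum (hit (recolor (ψ j) u w z) i u) ≡ outRest i xor δ z i
      out-sum j z i = trans (sum-rest (hit (recolor (ψ j) u w z) i u) w) (cong₂ _xor_
        (rest-cong w (λ y y≢w → hit-cong {recolor (ψ j) u w z} {ψ false} i (λ uy →
          trans (recolor-off (ψ j) z (λ _ → y≢w)) (agree (descends u∉F uy) j false))))
        (cong₂ _∧_ (to T-≡ arc) (cong (λ c → δ c i) (recolor-at (ψ j) u w z))))

      options : ∃ λ (z : Bool → Fin 3) → z false ≢ z true × ∀ c → ∃ λ j → Satisfied (recolor (ψ j) u w (z c)) u
      options with incoming
      ... | inj₁ noIn =
        -- At a source the in-condition is vacuous, so a zero vector and two arbitrary distinct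
        -- colors stand in for the in-arcs; what counts is the out-half of the answer.
        let z , z≢ , meets = transfer (const false) outRest (λ b → if b then 1F else 0F) (λ ())
        in z , z≢ , λ c → let _ , i , _ , out = meets c in
           false , satisfiedBy i (const (trans (out-sum false (z c) i) out)) (λ ne → contradiction ne noIn)
      ... | inj₂ E@(entry t _ differ _) =
        let z , z≢ , meets = transfer (λ i → rest (λ x → hit (ψ false) i x u) t) outRest (λ j → ψ j t u) differ
        in z , z≢ , λ c → let j , i , inn , out = meets c in
           j , satisfiedBy i (const (trans (out-sum j (z c) i) out))
                              (const (trans (in-sum E (recolor (ψ j) u w (z c)) j i (column j (z c))) inn))

      -- The recolored arc has head `w`, so the new alternatives still agree on all arcs with heads
      -- of rank below `w`. Recoloring affects only `u`, satisfied by `options`, and `w`, on which a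
      -- fork at `w` promises nothing yet.
      advance : F w ≡ false → Fork (λ x → P x ⊎ x ≡ u) w
      advance w∉F = record
        { ψ         = ψ′
        ; valid     = λ c → recolor-valid (valid (j c)) λ
            { (inj₁ u∈F) → contradiction (trans (sym u∈F) u∉F) λ () ; (inj₂ w∈F) → contradiction (trans (sym w∈F) w∉F) λ () }
        ; satisfied = λ c x≢w px⊎ → satisfied-∪ {P = λ x → x ≢ w × P x} {ψ′ c}
            (λ x≢u (x≢w , px) → recolor-satisfied x≢u x≢w (satisfied (j c) x≢u px))
            (proj₂ (proj₂ (proj₂ options) c)) (map₁ (x≢w ,_) px⊎)
        ; agree     = λ {x} {y} y<w b c → let off = λ (_ : x ≡ u) → λ { refl → <-irrefl refl y<w } in
            trans (recolor-off (ψ (j b)) (z b) off)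
              (trans (agree (<-trans y<w (descends u∉F arc)) (j b) (j c)) (sym (recolor-off (ψ (j c)) (z c) off)))
        ; incoming  = inj₂ (entry u arc
            (λ eq → proj₁ (proj₂ options) (trans (sym (recolor-at (ψ (j false)) u w (z false)))
                      (trans eq (recolor-at (ψ (j true)) u w (z true)))))
            (λ x≢u b c → let off = λ x≡u → contradiction x≡u x≢u in
              trans (recolor-off (ψ (j b)) (z b) off)
                (trans (agree (descends u∉F arc) (j b) (j c)) (sym (recolor-off (ψ (j c)) (z c) off)))))
        }
        where
        z : Bool → Fin 3
        z = proj₁ options

        j : Bool → Bool
        j c = proj₁ (proj₂ (proj₂ options) c)

        ψ′ : Bool → Coloring
        ψ′ c = recolor (ψ (j c)) u w (z c)

      land : F w ≡ true → Colored (λ x → P x ⊎ x ≡ u)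
      land w∈F with options
      ... | z , z≢ , sats = recolor (ψ j) u w (z c) , valid′ , sat
        where
        not2 : ∃ λ c → z c ≢ 2F
        not2 with z false Fin.≟ 2F
        ... | no  z₀≢2 = false , z₀≢2
        ... | yes z₀≡2 = true , λ z₁≡2 → z≢ (trans z₀≡2 (sym z₁≡2))

        c j : Bool
        c = proj₁ not2
        j = proj₁ (sats c)

        valid′ : Valid (recolor (ψ j) u w (z c))
        valid′ = recolor-valid (valid j) (λ _ → trans (δ-≢ (proj₂ not2)) (sym (onCycle-tail w u∉F)))

        sat : ∀ {x} → P x ⊎ x ≡ u → Satisfied (recolor (ψ j) u w (z c)) x
        sat = satisfied-∪ (λ {x} x≢u px → go x≢u px (x Fin.≟ w)) (proj₂ (sats c))
          where
          go : ∀ {x} → x ≢ u → P x → Dec (x ≡ w) → Satisfied (recolor (ψ j) u w (z c)) x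
          -- Recoloring changed an in-arc of `w`, but any valid coloring satisfies a vertex on a
          -- cycle.
          go _   _  (yes refl) = F-satisfied {recolor (ψ j) u w (z c)} valid′ w∈F
          go x≢u px (no x≢w)   = recolor-satisfied x≢u x≢w (satisfied j x≢u px)

    stop : ¬ OutNonempty D u → Colored (λ x → P x ⊎ x ≡ u)
    stop noOut = ψ (proj₁ final) , valid _ , satisfied-∪ (satisfied _) (proj₂ final)
      where
      final : ∃ λ j → Satisfied (ψ j) u
      final with incoming
      ... | inj₁ noIn = false , satisfiedBy 0F (λ ne → contradiction ne noOut) (λ ne → contradiction ne noIn)
      ... | inj₂ E@(entry t _ differ _) =
        -- At a sink the out-condition is vacuous, so a zero vector stands in for the out-arcs;
        -- taking `meets false` is an arbitrary choice.
        let _ , _ , meets = transfer (λ i → rest (λ x → hit (ψ false) i x u) t) (const false) (λ j → ψ j t u) differ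
            j , i , inn , _ = meets false
        in j , satisfiedBy i (λ ne → contradiction ne noOut) (const (trans (in-sum E (ψ j) j i (λ _ → refl)) inn))

  -- Ranks fall along the path, so it reaches a sink or a cycle.
  descend : ∀ {P u} → Acc _<_ (rank u) → F u ≡ false → Fork P u → Colored (λ x → P x ⊎ x ≡ u)
  descend {P} {u} (acc smaller) u∉F S with any? (λ w → T? (adj D u w))
  ... | no noOut = stop u∉F S noOut
  ... | yes (w , arc) with F w in w∈F
  ...   | true  = land u∉F S arc w∈F
  ...   | false = let φ , valid , sat = descend (smaller (descends u∉F arc)) w∈F (advance u∉F S arc w∈F)
                  in φ , valid , sat ∘ inj₁

  -- Finds the start of the path by walking backwards from `u`, and carries the fork forward by
  -- `advance` as the recursion returns. Ranks rise on the way back, hence the measure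
  -- `bound ∸ rank u`.
  ascend : ∀ {P u} → Acc _<_ (bound ∸ rank u) → F u ≡ false → Colored P → Fork P u
  ascend {P} {u} (acc smaller) u∉F (φ , valid , sat) with any? (λ t → T? (adj D t u))
  -- At a source both alternatives are the given coloring; the freedom starts with the arc that
  -- leaves `u`.
  ... | no noIn = record { ψ = const φ ; valid = const valid ; satisfied = λ _ _ → sat
                         ; agree = λ _ _ _ → refl ; incoming = inj₁ noIn }
  ... | yes (t , arc) with F t in t∈F
  ...   | false = record { Fork S ; satisfied = λ b x≢u px → Fork.satisfied S b x≢u (inj₁ px) }
    where
    S : Fork (λ x → P x ⊎ x ≡ t) u
    S = advance t∈F (ascend (smaller (∸-monoʳ-< (descends t∈F arc) (<⇒≤ (rank< t)))) t∈F (φ , valid , sat)) arc u∉F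
  ...   | true = record
    { ψ         = ψ
    ; valid     = valid′
    ; satisfied = sat′
    ; agree     = λ {x} y<u b c → let off = λ (_ : x ≡ t) → λ { refl → <-irrefl refl y<u } in
                    trans (recolor-off φ (color b) off) (sym (recolor-off φ (color c) off))
    ; incoming  = inj₂ (entry t arc
        (λ eq → contradiction (trans (sym (recolor-at φ t u 0F)) (trans eq (recolor-at φ t u 1F))) λ ())
        (λ x≢t b c → let off = λ x≡t → contradiction x≡t x≢t in
          trans (recolor-off φ (color b) off) (sym (recolor-off φ (color c) off))))
    }
    where
    -- Both colors differ from 2, so an arc that leaves a cycle may take either and `t` stays
    -- satisfied.
    color : Bool → Fin 3
    color b = if b then 1F else 0F

    ψ : Bool → Coloring
    ψ b = recolor φ t u (color b)

    valid′ : ∀ b → Valid (ψ b)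
    valid′ b = recolor-valid valid (λ _ → trans (color≢2 b) (sym (onCycle-head t u∉F)))
      where
      color≢2 : ∀ b → δ (color b) 2F ≡ false
      color≢2 true  = refl
      color≢2 false = refl

    sat′ : ∀ b {x} → x ≢ u → P x → Satisfied (ψ b) x
    sat′ b {x} x≢u px = go (x Fin.≟ t)
      where
      go : Dec (x ≡ t) → Satisfied (ψ b) x
      go (yes refl) = F-satisfied {ψ b} (valid′ b) t∈F
      go (no x≢t)   = recolor-satisfied x≢t x≢u (sat px)

  -- Vertices are treated one by one. A path may run through vertices treated before, but `ascend`
  -- and `descend` keep all of `P` satisfied.
  satisfyAll : ∀ xs → Colored (_∈ˡ xs)
  satisfyAll [] = (λ x y → if onCycle x y then 2F else 0F) , (λ {x} {y} _ _ → two (onCycle x y)) , λ ()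
    where
    two : ∀ b → δ {3} (if b then 2F else 0F) 2F ≡ b
    two true  = refl
    two false = refl
  satisfyAll (v ∷ xs) with satisfyAll xs | F v in v∈F
  ... | φ , valid , sat | true = φ , valid , λ { (here refl) → F-satisfied {φ} valid v∈F ; (there x∈) → sat x∈ }
  ... | C | false with descend (<-wellFounded _) v∈F (ascend (<-wellFounded _) v∈F C)
  ...   | φ , valid , sat = φ , valid , λ { (here eq) → sat (inj₂ eq) ; (there x∈) → sat (inj₁ x∈) }

  colorable : WOColorable D 3
  colorable with satisfyAll (allFin (n D))
  ... | φ , _ , sat = φ′ , λ v → OddAt⇒WO D φ′ (oddAt (sat (∈-allFin v)))
    where
    φ′ : Arc D → Fin 3
    φ′ ((x , y) , _) = φ x y

    oddAt : ∀ {v} → Satisfied φ v → ∃ (OddAt D φ′ v)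
    oddAt {v} (satisfiedBy i out inn) = i
      , (λ ne → trans (sum-cong-≗ (λ w → bit-const (adj D v w))) (out ne))
      , (λ ne → trans (sum-cong-≗ (λ w → bit-const (adj D w v))) (inn ne))

-- Equality of the two indices.

colorable₃ : ∀ D → WOColorable D 3
colorable₃ D = ThreeColors.colorable D (Cycles.cycleCover D ⊤ (⊂-wellFounded ⊤))

colorable-extended⁻ : ∀ D (s : Fin (n D) → ℕ) → (∀ i → 1 ≤ s i) → (∀ i → Odd (s i)) →
                      ∀ k → WOColorable (extended D s) k → WOColorable D k
colorable-extended⁻ D s 1≤s s-odd 0 = colorable₀ D s s-odd 1≤s
colorable-extended⁻ D s 1≤s s-odd 1 = colorable₁ D s s-odd 1≤s
colorable-extended⁻ D s 1≤s s-odd 2 = colorable₂ D s s-odd 1≤s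
colorable-extended⁻ D s 1≤s s-odd (suc (suc (suc k))) _ = WOColorable-mono D (s≤s (s≤s (s≤s z≤n))) (colorable₃ D)

theorem4p1 : (D : Digraph) (s : Fin (n D) → ℕ)
    → (∀ i → 1 ≤ s i) → (∀ i → Odd (s i))
    → ∀ k → IsWOChromaticIndex (extended D s) k ⇔ IsWOChromaticIndex D k
theorem4p1 D s 1≤s s-odd k = mk⇔
  (λ (colorable , least) → down k colorable , λ j → least j ∘ up j)
  (λ (colorable , least) → up k colorable , λ j → least j ∘ down j)
  where
  up : ∀ j → WOColorable D j → WOColorable (extended D s) j
  up j = colorable-extended D s s-odd

  down : ∀ j → WOColorable (extended D s) j → WOColorable D j
  down = colorable-extended⁻ D s 1≤s s-odd
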